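{- Let $C$ be any cycle (of any length $\ge 3$) whose edges are each colored red or blue. Then $\mathrm{mex}(2,C)\le 1/2$.
   Context: Given graphs $R$ (red) and $B$ (blue) on a common $n$-vertex set, $R\sqcup B$ denotes the $2$-edge-colored multigraph whose red edges are $E(R)$ and blue edges are $E(B)$. It contains a copy of a red/blue-colored graph $H$ if there is an injective map $\phi:V(H)\to V$ such that every red edge $xy$ of $H$ has $\phi(x)\phi(y)\in E(R)$ and every blue edge has $\phi(x)\phi(y)\in E(B)$. $\mathrm{mex}(2,n,H)$ is the largest integer $T$ such that there are such $R,B$ with $|E(R)|,|E(B)|\ge T$ and $R\sqcup B$ containing no copy of $H$, and $\mathrm{mex}(2,H)=\lim_{n\to\infty}\mathrm{mex}(2,n,H)/\binom n2$. -}

module Defs where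

open import Data.Nat using (ℕ; zero; suc; _+_; _*_; _≤_; _<ᵇ_)
open import Data.Nat.DivMod using (_mod_)
open import Data.Bool using (Bool; true; false; _∧_; if_then_else_)
open import Data.Fin using (Fin; toℕ)
open import Data.List using (List; map; cartesianProduct; allFin)
open import Data.Nat.ListAction using (sum)
open import Data.Product using (Σ; _×_; _,_)
open import Function.Definitions using (Injective)
open import Relation.Binary.PropositionalEquality using (_≡_)
open import Relation.Nullary using (¬_)

record Graph (n : ℕ) : Set where
  field
    adj   : Fin n → Fin n → Bool
    sym   : ∀ x y → adj x y ≡ adj y x
    irrefl : ∀ x → adj x x ≡ false
open Graph public

Edge : ∀ {n} → Graph n → Fin n → Fin n → Set
Edge G x y = adj G x y ≡ true

edges : ∀ {n} → Graph n → ℕ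
edges {n} G = sum (map (λ { (x , y) → if (toℕ x <ᵇ toℕ y) ∧ adj G x y then 1 else 0 })
                       (cartesianProduct (allFin n) (allFin n)))

next : ∀ {m} → Fin (suc m) → Fin (suc m)
next {m} i = suc (toℕ i) mod (suc m)

-- A red/blue-colored cycle of length m = suc l is given by a colouring
-- col : Fin (suc l) → Bool of its edges {i, i+1 mod m}; true = red, false = blue.
-- R ⊔ B contains a copy of that colored cycle:
ContainsCycle : ∀ {n l} → Graph n → Graph n → (Fin (suc l) → Bool) → Set
ContainsCycle {n} {l} R B col =
  Σ (Fin (suc l) → Fin n) λ φ →
    Injective _≡_ _≡_ φ ×
    (∀ i → if col i then Edge R (φ i) (φ (next i)) else Edge B (φ i) (φ (next i)))

choose2 : ℕ → ℕ
choose2 zero = zero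
choose2 (suc n) = n + choose2 n

{-# OPTIONS --safe #-}
-- Let G and H be the graphs carrying the colours of two consecutive edges of the cycle, chosen
-- so that no other colour occurs (G = H if the cycle is monochromatic). Together they have more
-- than (1 + ε) (n choose 2) edges, so deleting vertices of small total degree d = d_G + d_H
-- leaves a large set S in which every d exceeds (1 + 1/q) |S|. Every vertex of S then has many
-- neighbours in G ∩ H, hence G ∩ H contains arbitrarily long paths in S; all edges of the cycle
-- but the two chosen ones go there, whatever their colours. If u and v are the ends of the path,
-- d_G(u) + d_H(v) and d_H(u) + d_G(v) have sum d(u) + d(v), so one of them exceeds
-- (1 + 1/q) |S|; this gives many vertices that close the path with one edge of G and one of H.
module Submission where

open import Defs
open import Data.Nat using (ℕ; zero; suc; _+_; _*_; _∸_; _≤_; _<_; _<ᵇ_; z≤n; s≤s)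
open import Data.Nat.Properties hiding (_≟_)
open import Data.Nat.DivMod using (_%_; m%n<n; m<n⇒m%n≡m; n%n≡0; m%n%n≡m%n; %-distribˡ-+; [m+n]%n≡m%n)
open import Data.Nat.ListAction using (sum)
open import Data.Nat.ListAction.Properties using (sum-++; sum-↭)
open import Data.Nat.Tactic.RingSolver using (solve-∀)
open import Data.Bool using (Bool; true; false; _∧_; not; if_then_else_)
open import Data.Bool.Properties using () renaming (_≟_ to _≟ᵇ_)
open import Data.Fin using (Fin; zero; toℕ; fromℕ<)
open import Data.Fin.Properties using (_≟_; any?; toℕ<n; toℕ-fromℕ<; toℕ-injective)
open import Data.List using (List; []; _∷_; _++_; map; length; cartesianProduct; allFin; applyUpTo)
open import Data.List.Properties using (map-++; map-∘; length-applyUpTo; length-tabulate)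
open import Data.List.Membership.Propositional using (_∈_; _∉_; find)
open import Data.List.Membership.Propositional.Properties using (∈-∃++; ∈-applyUpTo⁺)
open import Data.List.Relation.Unary.All as All using (All; []; _∷_; search)
open import Data.List.Relation.Unary.Any using (here; there)
open import Data.List.Relation.Unary.AllPairs using (_∷_)
open import Data.List.Relation.Unary.Unique.Propositional using (Unique)
open import Data.List.Relation.Unary.Unique.Propositional.Properties using (allFin⁺)
open import Data.List.Relation.Binary.Permutation.Propositional using (_↭_; ↭⇒↭ₛ)
open import Data.List.Relation.Binary.Permutation.Propositional.Properties using (map⁺; ↭-length; shift)
open import Data.List.Relation.Binary.Permutation.Setoid.Properties using (Unique-resp-↭)
open import Data.Product using (Σ; ∃; _×_; _,_)
open import Data.Sum using (_⊎_; inj₁; inj₂)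
open import Function using (_∘_)
open import Function.Definitions using (Injective)
open import Relation.Nullary using (¬_; yes; no; contradiction; does)
open import Relation.Nullary.Decidable using (¬?; decidable-stable)
open import Relation.Binary.PropositionalEquality
  using (_≡_; _≢_; refl; trans; cong; cong₂; subst; setoid; module ≡-Reasoning)
  renaming (sym to ≡-sym)

private variable
  A A′ : Set

-- Sums and counts over finite lists

𝟙 : Bool → ℕ
𝟙 b = if b then 1 else 0

∑ : List A → (A → ℕ) → ℕ
∑ xs f = sum (map f xs)

∑-mono : ∀ (xs : List A) {f g : A → ℕ} → (∀ x → f x ≤ g x) → ∑ xs f ≤ ∑ xs g
∑-mono []       f≤g = z≤n
∑-mono (x ∷ xs) f≤g = +-mono-≤ (f≤g x) (∑-mono xs f≤g)

∑-cong : ∀ (xs : List A) {f g : A → ℕ} → (∀ x → f x ≡ g x) → ∑ xs f ≡ ∑ xs g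
∑-cong []       f≡g = refl
∑-cong (x ∷ xs) f≡g = cong₂ _+_ (f≡g x) (∑-cong xs f≡g)

∑-+ : ∀ (xs : List A) (f g : A → ℕ) → ∑ xs (λ x → f x + g x) ≡ ∑ xs f + ∑ xs g
∑-+ []       f g = refl
∑-+ (x ∷ xs) f g rewrite ∑-+ xs f g = interchange (f x) (g x) (∑ xs f) (∑ xs g)
  where
  interchange : ∀ a b c d → a + b + (c + d) ≡ a + c + (b + d)
  interchange = solve-∀

∑-const : ∀ (xs : List A) c → ∑ xs (λ _ → c) ≡ length xs * c
∑-const []       c = refl
∑-const (x ∷ xs) c = cong (c +_) (∑-const xs c)

∑-one : ∀ (xs : List A) → ∑ xs (λ _ → 1) ≡ length xs
∑-one xs = trans (∑-const xs 1) (*-identityʳ (length xs))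

∑-swap : ∀ (xs : List A) (ys : List A′) (f : A → A′ → ℕ) →
  ∑ xs (λ x → ∑ ys (f x)) ≡ ∑ ys (λ y → ∑ xs (λ x → f x y))
∑-swap []       ys f = ≡-sym (trans (∑-const ys 0) (*-zeroʳ (length ys)))
∑-swap (x ∷ xs) ys f = trans (cong (∑ ys (f x) +_) (∑-swap xs ys f)) (≡-sym (∑-+ ys (f x) _))

∑-↭ : ∀ {xs ys : List A} (f : A → ℕ) → xs ↭ ys → ∑ xs f ≡ ∑ ys f
∑-↭ f = sum-↭ ∘ map⁺ f

∑-cartesianProduct : ∀ (xs : List A) (ys : List A′) (f : A × A′ → ℕ) →
  ∑ (cartesianProduct xs ys) f ≡ ∑ xs (λ x → ∑ ys (λ y → f (x , y)))
∑-cartesianProduct []       ys f = refl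
∑-cartesianProduct (x ∷ xs) ys f = begin
  sum (map f (map (x ,_) ys ++ cartesianProduct xs ys))
    ≡⟨ cong sum (map-++ f (map (x ,_) ys) _) ⟩
  sum (map f (map (x ,_) ys) ++ map f (cartesianProduct xs ys))
    ≡⟨ sum-++ (map f (map (x ,_) ys)) _ ⟩
  sum (map f (map (x ,_) ys)) + ∑ (cartesianProduct xs ys) f
    ≡⟨ cong₂ _+_ (cong sum (≡-sym (map-∘ ys))) (∑-cartesianProduct xs ys f) ⟩
  ∑ ys (λ y → f (x , y)) + ∑ xs (λ x → ∑ ys (λ y → f (x , y))) ∎
  where open ≡-Reasoning

-- Inclusion-exclusion, checked pointwise. It turns two degrees with sum above `length xs` into
-- common neighbours.
∑-𝟙-∧ : ∀ (xs : List A) (p q : A → Bool) →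
  ∑ xs (𝟙 ∘ p) + ∑ xs (𝟙 ∘ q) ≤ ∑ xs (λ x → 𝟙 (p x ∧ q x)) + length xs
∑-𝟙-∧ xs p q = begin
  ∑ xs (𝟙 ∘ p) + ∑ xs (𝟙 ∘ q)                   ≡⟨ ∑-+ xs _ _ ⟨
  ∑ xs (λ x → 𝟙 (p x) + 𝟙 (q x))               ≤⟨ ∑-mono xs (λ x → bound (p x) (q x)) ⟩
  ∑ xs (λ x → 𝟙 (p x ∧ q x) + 1)               ≡⟨ ∑-+ xs _ _ ⟩
  ∑ xs (λ x → 𝟙 (p x ∧ q x)) + ∑ xs (λ _ → 1)  ≡⟨ cong (∑ xs (λ x → 𝟙 (p x ∧ q x)) +_) (∑-one xs) ⟩
  ∑ xs (λ x → 𝟙 (p x ∧ q x)) + length xs       ∎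
  where
  open ≤-Reasoning
  bound : ∀ a b → 𝟙 a + 𝟙 b ≤ 𝟙 (a ∧ b) + 1
  bound false false = z≤n
  bound false true  = ≤-refl
  bound true  false = ≤-refl
  bound true  true  = ≤-refl

∑-positive : ∀ (xs : List A) (p : A → Bool) → 0 < ∑ xs (𝟙 ∘ p) → ∃ λ x → x ∈ xs × p x ≡ true
∑-positive (x ∷ xs) p 0<s with p x in px
... | true  = x , here refl , px
... | false with y , y∈xs , py ← ∑-positive xs p 0<s = y , there y∈xs , py

multiplicity≤1 : ∀ {n} {xs : List (Fin n)} → Unique xs → ∀ u → ∑ xs (λ x → 𝟙 (does (x ≟ u))) ≤ 1
multiplicity≤1 {xs = []}     _           u = z≤n
multiplicity≤1 {xs = x ∷ xs} (x∉xs ∷ uq) u with x ≟ u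
... | no  _    = multiplicity≤1 uq u
... | yes refl = s≤s (≤-reflexive (none x∉xs))
  where
  none : ∀ {ys} → All (u ≢_) ys → ∑ ys (λ y → 𝟙 (does (y ≟ u))) ≡ 0
  none []                       = refl
  none {ys = y ∷ _} (u≢y ∷ u∉) with y ≟ u
  ... | yes y≡u = contradiction (≡-sym y≡u) u≢y
  ... | no  _   = none u∉

-- Induction on `us`: excluding `u` from `p` lowers the count by at most one, because `xs` has no
-- repetitions.
∃-fresh : ∀ {n} {xs : List (Fin n)} → Unique xs → (us : List (Fin n)) (p : Fin n → Bool) →
  length us < ∑ xs (𝟙 ∘ p) → ∃ λ x → x ∈ xs × p x ≡ true × x ∉ us
∃-fresh {xs = xs} uq []       p us<p with x , x∈xs , px ← ∑-positive xs p us<p = x , x∈xs , px , λ ()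
∃-fresh {xs = xs} uq (u ∷ us) p us<p
  = let x , x∈xs , p′x , x∉us = ∃-fresh uq us p′ (≤-pred (≤-trans us<p count))
    in x , x∈xs , split x p′x x∉us
  where
  p′ : _ → Bool
  p′ x = p x ∧ not (does (x ≟ u))
  bound : ∀ a b → 𝟙 a ≤ 𝟙 b + 𝟙 (a ∧ not b)
  bound false b     = z≤n
  bound true  false = ≤-refl
  bound true  true  = ≤-refl
  count : ∑ xs (𝟙 ∘ p) ≤ 1 + ∑ xs (𝟙 ∘ p′)
  count = begin
    ∑ xs (𝟙 ∘ p)                                        ≤⟨ ∑-mono xs (λ x → bound (p x) (does (x ≟ u))) ⟩
    ∑ xs (λ x → 𝟙 (does (x ≟ u)) + 𝟙 (p′ x))           ≡⟨ ∑-+ xs _ _ ⟩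
    ∑ xs (λ x → 𝟙 (does (x ≟ u))) + ∑ xs (𝟙 ∘ p′)      ≤⟨ +-monoˡ-≤ _ (multiplicity≤1 uq u) ⟩
    1 + ∑ xs (𝟙 ∘ p′)                                   ∎
    where open ≤-Reasoning
  split : ∀ x → p′ x ≡ true → x ∉ us → p x ≡ true × x ∉ u ∷ us
  split x p′x x∉us with p x | x ≟ u
  ... | true | no x≢u = refl , λ { (here x≡u) → x≢u x≡u ; (there x∈us) → x∉us x∈us }

-- Deleting vertices of small degree

module Prune (w : A → A → ℕ) (w-sym : ∀ x y → w x y ≡ w y x) where

  degree : List A → A → ℕ
  degree S v = ∑ S (w v)

  weight : List A → ℕ
  weight S = ∑ S (degree S)

  weight-↭ : ∀ {S S′} → S ↭ S′ → weight S ≡ weight S′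
  weight-↭ {S} {S′} S↭S′ = trans (∑-cong S (λ x → ∑-↭ (w x) S↭S′)) (∑-↭ (degree S′) S↭S′)

  -- `weight` runs over ordered pairs, so `v` adds a row and, by symmetry, an equal column; the
  -- right side counts the diagonal entry `w v v` twice.
  weight-∷ : ∀ v S → weight (v ∷ S) ≤ weight S + 2 * degree (v ∷ S) v
  weight-∷ v S = begin
    degree (v ∷ S) v + ∑ S (λ x → w x v + degree S x)
      ≡⟨ cong (degree (v ∷ S) v +_) (∑-+ S (λ x → w x v) (degree S)) ⟩
    degree (v ∷ S) v + (∑ S (λ x → w x v) + weight S)
      ≡⟨ cong (λ d → degree (v ∷ S) v + (d + weight S)) (∑-cong S (λ x → w-sym x v)) ⟩
    degree (v ∷ S) v + (degree S v + weight S)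
      ≤⟨ +-monoʳ-≤ (degree (v ∷ S) v) (+-monoˡ-≤ (weight S) (m≤n+m (degree S v) (w v v))) ⟩
    degree (v ∷ S) v + (degree (v ∷ S) v + weight S)
      ≡⟨ rearrange (degree (v ∷ S) v) (weight S) ⟩
    weight S + 2 * degree (v ∷ S) v ∎
    where
    open ≤-Reasoning
    rearrange : ∀ d s → d + (d + s) ≡ s + 2 * d
    rearrange = solve-∀

  -- The potential (q + 1) s (s + 1) drops by exactly 2 (q + 1) s when s decreases by one,
  -- which is at least what q * weight loses with a vertex of degree ≤ (1 + 1/q) s.
  Dense : ℕ → ℕ → List A → Set
  Dense q K S = suc q * (length S * suc (length S)) + K ≤ q * weight S

  -- `Dense` is the invariant: while some vertex violates the degree bound, delete it. The slack `K`
  -- is never spent; `k` bounds the length and makes the recursion structural.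
  prune : ∀ q K (k : ℕ) S → length S ≤ k → Unique S → Dense q K S →
    ∃ λ S′ → Unique S′ × Dense q K S′ × All (λ v → suc q * length S′ < q * degree S′ v) S′
  prune q K k S |S|≤k uq dense with search (λ v → q * degree S v ≤? suc q * length S) S
  ... | inj₁ all-large = S , uq , dense , All.map ≰⇒> all-large
  ... | inj₂ some-small
    with v , v∈S , dv≤ ← find some-small
    with ys , zs , refl ← ∈-∃++ v∈S = finish k |S|≤k
    where
    S′ = ys ++ zs
    S↭ : S ↭ v ∷ S′
    S↭ = shift v ys zs
    uq′ : Unique S′
    uq′ with _ ∷ u ← Unique-resp-↭ (setoid _) (↭⇒↭ₛ S↭) uq = u
    |S|≡ : length S ≡ suc (length S′)
    |S|≡ = ↭-length S↭
    dense′ : Dense q K S′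
    dense′ = +-cancelʳ-≤ (2 * (suc q * suc s)) _ _ (begin
      suc q * (s * suc s) + K + 2 * (suc q * suc s)    ≡⟨ expand q s K ⟩
      suc q * (suc s * suc (suc s)) + K                ≡⟨ cong (λ t → suc q * (t * suc t) + K) |S|≡ ⟨
      suc q * (length S * suc (length S)) + K          ≤⟨ dense ⟩
      q * weight S                                     ≡⟨ cong (q *_) (weight-↭ S↭) ⟩
      q * weight (v ∷ S′)                              ≤⟨ *-monoʳ-≤ q (weight-∷ v S′) ⟩
      q * (weight S′ + 2 * degree (v ∷ S′) v)          ≡⟨ cong (λ d → q * (weight S′ + 2 * d)) (∑-↭ (w v) S↭) ⟨
      q * (weight S′ + 2 * degree S v)                 ≡⟨ distrib q (weight S′) (degree S v) ⟩
      q * weight S′ + 2 * (q * degree S v)             ≤⟨ +-monoʳ-≤ (q * weight S′) (*-monoʳ-≤ 2 dv≤) ⟩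
      q * weight S′ + 2 * (suc q * length S)           ≡⟨ cong (λ t → q * weight S′ + 2 * (suc q * t)) |S|≡ ⟩
      q * weight S′ + 2 * (suc q * suc s)              ∎)
      where
      open ≤-Reasoning
      s = length S′
      expand : ∀ q s K → (1 + q) * (s * (1 + s)) + K + 2 * ((1 + q) * (1 + s)) ≡ (1 + q) * ((1 + s) * (2 + s)) + K
      expand = solve-∀
      distrib : ∀ q a b → q * (a + 2 * b) ≡ q * a + 2 * (q * b)
      distrib = solve-∀
    finish : ∀ k → length S ≤ k → _
    finish zero    |S|≤0 = contradiction (subst (_≤ 0) |S|≡ |S|≤0) λ ()
    finish (suc k) |S|≤k = prune q K k S′ (≤-pred (subst (_≤ suc k) |S|≡ |S|≤k)) uq′ dense′

  weight≤ : (∀ x y → w x y ≤ 2) → ∀ S → weight S ≤ 2 * (length S * length S)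
  weight≤ w≤2 S = begin
    weight S                          ≤⟨ ∑-mono S (λ x → ∑-mono S (w≤2 x)) ⟩
    ∑ S (λ _ → ∑ S (λ _ → 2))        ≡⟨ ∑-const S _ ⟩
    length S * ∑ S (λ _ → 2)         ≡⟨ cong (length S *_) (∑-const S 2) ⟩
    length S * (length S * 2)         ≡⟨ rearrange (length S) ⟩
    2 * (length S * length S)         ∎
    where
    open ≤-Reasoning
    rearrange : ∀ s → s * (s * 2) ≡ 2 * (s * s)
    rearrange = solve-∀

  -- A list of length at most `M` has `q * weight` below this slack, so the slack preserved by
  -- pruning keeps the remaining set large.
  dense⇒long : (∀ x y → w x y ≤ 2) → ∀ q M S → Dense q (suc (q * (2 * (M * M)))) S → M < length S
  dense⇒long w≤2 q M S dense = ≰⇒> λ |S|≤M → <-irrefl refl (begin-strict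
    q * (2 * (M * M))                                          <⟨ n<1+n _ ⟩
    suc (q * (2 * (M * M)))                                    ≤⟨ m≤n+m _ _ ⟩
    suc q * (length S * suc (length S)) + suc (q * (2 * (M * M))) ≤⟨ dense ⟩
    q * weight S                                               ≤⟨ *-monoʳ-≤ q (weight≤ w≤2 S) ⟩
    q * (2 * (length S * length S))                            ≤⟨ *-monoʳ-≤ q (*-monoʳ-≤ 2 (*-mono-≤ |S|≤M |S|≤M)) ⟩
    q * (2 * (M * M))                                          ∎)
    where open ≤-Reasoning

-- Greedy embedding

∧-true : ∀ {a b} → a ∧ b ≡ true → a ≡ true × b ≡ true
∧-true {true} b≡true = refl , b≡true

module Embed {n} (G H : Graph n) (q m : ℕ) {S : List (Fin n)} (uq : Unique S) where

  count : (Fin n → Bool) → ℕ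
  count p = ∑ S (𝟙 ∘ p)

  -- `L` counts edges. Indexing by all of `ℕ` avoids arithmetic in `Fin`; values beyond `L` are
  -- arbitrary members of `S`.
  record Path (L : ℕ) : Set where
    field
      at   : ℕ → Fin n
      at∈S : ∀ i → at i ∈ S
      inj  : ∀ {i j} → i ≤ L → j ≤ L → at i ≡ at j → i ≡ j
      both : ∀ i → i < L → Edge G (at i) (at (suc i)) × Edge H (at i) (at (suc i))
  open Path

  reverse : ∀ {L} → Path L → Path L
  reverse {L} P .at i = at P (L ∸ i)
  reverse {L} P .at∈S i = at∈S P _
  reverse {L} P .inj {i} {j} i≤L j≤L eq = ∸-cancelˡ-≡ i≤L j≤L (inj P (m∸n≤m L i) (m∸n≤m L j) eq)
  -- Edge `i` of the reversal is edge `L ∸ suc i` of `P` run backwards; for `i < L`, `L ∸ i` is the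
  -- successor of `L ∸ suc i`.
  reverse {L} P .both i i<L
    with L ∸ i | L ∸ suc i | ≡-sym (+-∸-assoc 1 i<L) | both P (L ∸ suc i) (∸-monoʳ-< {L} (s≤s z≤n) i<L)
  ... | .(suc d) | d | refl | eG , eH =
    trans (Graph.sym G _ _) eG , trans (Graph.sym H _ _) eH

  ∉-path : ∀ {L x} (P : Path L) → x ∉ applyUpTo (at P) (suc L) → ∀ i → i ≤ L → x ≢ at P i
  ∉-path P x∉ i i≤L refl = x∉ (∈-applyUpTo⁺ (at P) (s≤s i≤L))

  cons : A → (ℕ → A) → ℕ → A
  cons x f zero    = x
  cons x f (suc i) = f i

  cons-inj : ∀ {L} {x : A} {f : ℕ → A} →
    (∀ {i j} → i ≤ L → j ≤ L → f i ≡ f j → i ≡ j) → (∀ i → i ≤ L → x ≢ f i) →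
    ∀ {i j} → i ≤ suc L → j ≤ suc L → cons x f i ≡ cons x f j → i ≡ j
  cons-inj f-inj x∉ {zero}  {zero}  _         _         _  = refl
  cons-inj f-inj x∉ {zero}  {suc j} _         (s≤s j≤L) eq = contradiction eq (x∉ j j≤L)
  cons-inj f-inj x∉ {suc i} {zero}  (s≤s i≤L) _         eq = contradiction (≡-sym eq) (x∉ i i≤L)
  cons-inj f-inj x∉ {suc i} {suc j} (s≤s i≤L) (s≤s j≤L) eq = cong suc (f-inj i≤L j≤L eq)

  module _ (qm<|S| : q * m < length S)
           (large : ∀ {v} → v ∈ S → suc q * length S < q * (count (adj G v) + count (adj H v))) where

    -- Cancelling `q * length S` after inclusion-exclusion bounds `length S`, and hence `q * m`,
    -- strictly by `q` times the common count.
    many-common : ∀ p r → suc q * length S < q * (count p + count r) → m < count (λ x → p x ∧ r x)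
    many-common p r big = *-cancelˡ-< q _ _ (<-trans qm<|S| (+-cancelʳ-< (q * length S) _ _ (begin-strict
      length S + q * length S                           <⟨ big ⟩
      q * (count p + count r)                           ≤⟨ *-monoʳ-≤ q (∑-𝟙-∧ S p r) ⟩
      q * (count (λ x → p x ∧ r x) + length S)          ≡⟨ *-distribˡ-+ q _ (length S) ⟩
      q * count (λ x → p x ∧ r x) + q * length S        ∎)))
      where open ≤-Reasoning

    -- The path blocks only `suc L ≤ m` vertices, fewer than satisfy both predicates.
    extend : ∀ {L} (P : Path L) p r → suc L ≤ m → suc q * length S < q * (count p + count r) →
      ∃ λ x → x ∈ S × (p x ≡ true × r x ≡ true) × (∀ i → i ≤ L → x ≢ at P i)
    extend {L} P p r L<m big
      with x , x∈S , prx , x∉ ← ∃-fresh uq (applyUpTo (at P) (suc L)) (λ x → p x ∧ r x)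
             (≤-<-trans (≤-trans (≤-reflexive (length-applyUpTo (at P) (suc L))) L<m) (many-common p r big))
      = x , x∈S , ∧-true prx , ∉-path P x∉

    path : ∀ L → L ≤ m → Path L
    path zero    _
      with x , x∈S , _ ← ∑-positive S (λ _ → true)
             (subst (0 <_) (≡-sym (∑-one S)) (≤-<-trans z≤n qm<|S|))
      = record { at = λ _ → x ; at∈S = λ _ → x∈S ; inj = λ { z≤n z≤n _ → refl } ; both = λ _ () }
    path (suc L) L<m
      with P ← path L (<⇒≤ L<m)
      with x , x∈S , (eG , eH) , x∉ ← extend P (adj G (at P 0)) (adj H (at P 0)) L<m (large (at∈S P 0))
      = record
        { at   = cons x (at P)
        ; at∈S = λ { zero → x∈S ; (suc i) → at∈S P i }
        ; inj  = cons-inj (inj P) x∉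
        ; both = λ { zero    _         → trans (Graph.sym G _ _) eG , trans (Graph.sym H _ _) eH
                   ; (suc i) (s≤s i<L) → both P i i<L }
        }

    -- The two pairings of ends with graphs add up to the total degree of both ends, which exceeds
    -- twice the threshold. If the wanted pairing fails, the other succeeds, and reversal swaps the
    -- ends.
    oriented : ∀ L → L ≤ m → Σ (Path L) λ P →
      suc q * length S < q * (count (adj G (at P L)) + count (adj H (at P 0)))
    oriented L L≤m
      with P ← path L L≤m
      with suc q * length S <? q * (count (adj G (at P L)) + count (adj H (at P 0)))
    ... | yes big = P , big
    -- Index `L` of the reversal is `L ∸ L` in `P`, hence the transport along `n∸n≡0`; index `0`
    -- computes to `L`.
    ... | no  ¬big = reverse P , subst
        (λ i → suc q * length S < q * (count (adj G (at P i)) + count (adj H (at P L)))) (≡-sym (n∸n≡0 L)) big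
      where
      open ≤-Reasoning
      Gu = count (adj G (at P 0))
      Hu = count (adj H (at P 0))
      Gv = count (adj G (at P L))
      Hv = count (adj H (at P L))
      regroup : ∀ q a b c d → q * (a + b) + q * (c + d) ≡ q * (c + b) + q * (a + d)
      regroup = solve-∀
      big : suc q * length S < q * (Gu + Hv)
      big = +-cancelˡ-< (suc q * length S) _ _ (begin-strict
        suc q * length S + suc q * length S    <⟨ +-mono-< (large (at∈S P 0)) (large (at∈S P L)) ⟩
        q * (Gu + Hu) + q * (Gv + Hv)          ≡⟨ regroup q Gu Hu Gv Hv ⟩
        q * (Gv + Hu) + q * (Gu + Hv)          ≤⟨ +-monoˡ-≤ _ (≮⇒≥ ¬big) ⟩
        suc q * length S + q * (Gu + Hv)       ∎)

    -- `c 0` is the closing vertex and `c 1`, ..., `c (suc L)` are the path, so the cycle has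
    -- `L + 2` vertices. Only the two edges at `c 0` are tied to one graph each.
    cycle : ∀ L → suc L ≤ m → ∃ λ (c : ℕ → Fin n) →
      (∀ {i j} → i ≤ suc L → j ≤ suc L → c i ≡ c j → i ≡ j) ×
      (∀ i → i < L → Edge G (c (1 + i)) (c (2 + i)) × Edge H (c (1 + i)) (c (2 + i))) ×
      Edge G (c (suc L)) (c 0) × Edge H (c 0) (c 1)
    cycle L L<m
      with P , big ← oriented L (<⇒≤ L<m)
      with x , x∈S , (eG , eH) , x∉ ← extend P (adj G (at P L)) (adj H (at P 0)) L<m big
      = cons x (at P) , cons-inj (inj P) x∉ , both P , eG , trans (Graph.sym H _ _) eH

-- Rotations and colourings of the cycle

module _ {l : ℕ} where

  private
    M = suc l

    %-absorbˡ : ∀ a b → (a % M + b) % M ≡ (a + b) % M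
    %-absorbˡ a b = begin
      (a % M + b) % M              ≡⟨ %-distribˡ-+ (a % M) b M ⟩
      (a % M % M + b % M) % M      ≡⟨ cong (λ t → (t + b % M) % M) (m%n%n≡m%n a M) ⟩
      (a % M + b % M) % M          ≡⟨ %-distribˡ-+ a b M ⟨
      (a + b) % M                  ∎
      where open ≡-Reasoning

  toℕ-next : (i : Fin M) → toℕ (next i) ≡ suc (toℕ i) % M
  toℕ-next i = toℕ-fromℕ< (m%n<n (suc (toℕ i)) M)

  module Rotation (i₀ : Fin M) where

    private
      offset = l ∸ toℕ i₀
      i₀≤l : toℕ i₀ ≤ l
      i₀≤l = ≤-pred (toℕ<n i₀)

    -- The shift sends `i₀` to the last position `l`, hence `next i₀` to position `0`.
    position : Fin M → ℕ
    position i = (toℕ i + offset) % M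

    position≤l : ∀ i → position i ≤ l
    position≤l i = ≤-pred (m%n<n (toℕ i + offset) M)

    position-next : ∀ i → position (next i) ≡ suc (position i) % M
    position-next i = begin
      (toℕ (next i) + offset) % M          ≡⟨ cong (λ t → (t + offset) % M) (toℕ-next i) ⟩
      (suc (toℕ i) % M + offset) % M       ≡⟨ %-absorbˡ (suc (toℕ i)) offset ⟩
      suc (toℕ i + offset) % M             ≡⟨ cong (_% M) (+-comm 1 (toℕ i + offset)) ⟩
      (toℕ i + offset + 1) % M             ≡⟨ %-absorbˡ (toℕ i + offset) 1 ⟨
      (position i + 1) % M                 ≡⟨ cong (_% M) (+-comm (position i) 1) ⟩
      suc (position i) % M                 ∎
      where open ≡-Reasoning

    position-next-suc : ∀ i {p} → position i ≡ p → p < l → position (next i) ≡ suc p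
    position-next-suc i refl p<l = trans (position-next i) (m<n⇒m%n≡m (s≤s p<l))

    position-next-last : ∀ i → position i ≡ l → position (next i) ≡ 0
    position-next-last i p≡l = trans (position-next i) (trans (cong (λ t → suc t % M) p≡l) (n%n≡0 M))

    position-pivot : position i₀ ≡ l
    position-pivot = trans (cong (_% M) (m+[n∸m]≡n i₀≤l)) (m<n⇒m%n≡m (n<1+n l))

    position-injective : ∀ {i j} → position i ≡ position j → i ≡ j
    position-injective {i} {j} eq = toℕ-injective
      (trans (≡-sym (recover i)) (trans (cong (λ t → (t + suc (toℕ i₀)) % M) eq) (recover j)))
      where
      open ≡-Reasoning
      -- Adding `suc (toℕ i₀)` completes the offset to a full turn `M`, which undoes the shift.
      recover : ∀ i → (position i + suc (toℕ i₀)) % M ≡ toℕ i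
      recover i = begin
        (position i + suc (toℕ i₀)) % M                  ≡⟨ %-absorbˡ (toℕ i + offset) (suc (toℕ i₀)) ⟩
        (toℕ i + offset + suc (toℕ i₀)) % M              ≡⟨ cong (_% M) (+-assoc (toℕ i) offset _) ⟩
        (toℕ i + (offset + suc (toℕ i₀))) % M            ≡⟨ cong (λ t → (toℕ i + t) % M) (+-suc offset (toℕ i₀)) ⟩
        (toℕ i + suc (offset + toℕ i₀)) % M              ≡⟨ cong (λ t → (toℕ i + suc t) % M) (m∸n+n≡m i₀≤l) ⟩
        (toℕ i + M) % M                                  ≡⟨ [m+n]%n≡m%n (toℕ i) M ⟩
        toℕ i % M                                        ≡⟨ m<n⇒m%n≡m (toℕ<n i) ⟩
        toℕ i                                            ∎

    -- `Q` depends on the edge index and so can encode its colour. By injectivity of `position`,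
    -- only `next i₀` sits at `0` and only `i₀` at `l`; every other edge is inner.
    rotate : (Q : Fin M → A → A → Set) (c : ℕ → A) → 0 < l →
      (∀ {i j} → i ≤ l → j ≤ l → c i ≡ c j → i ≡ j) →
      (∀ i j → suc j < l → Q i (c (1 + j)) (c (2 + j))) →
      Q i₀ (c l) (c 0) → Q (next i₀) (c 0) (c 1) →
      ∃ λ (φ : Fin M → A) → Injective _≡_ _≡_ φ × (∀ i → Q i (φ i) (φ (next i)))
    rotate Q c 0<l c-inj inner last first =
      c ∘ position , (λ {i} {j} → position-injective ∘ c-inj (position≤l i) (position≤l j)) , edge
      where
      edge : ∀ i → Q i (c (position i)) (c (position (next i)))
      edge i with position i in eq
      edge i | zero
        with refl ← position-injective {i} {next i₀} (trans eq (≡-sym (position-next-last i₀ position-pivot)))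
        = subst (λ t → Q i (c 0) (c t)) (≡-sym (position-next-suc i eq 0<l)) first
      edge i | suc j with suc j <? l
      ... | yes j<l = subst (λ t → Q i (c (suc j)) (c t)) (≡-sym (position-next-suc i eq j<l)) (inner i j j<l)
      ... | no  j≮l with sj≡l ← ≤-antisym (subst (_≤ l) eq (position≤l i)) (≮⇒≥ j≮l)
                    with refl ← position-injective {i} {i₀} (trans eq (trans sj≡l (≡-sym position-pivot)))
        = subst (λ t → Q i (c (suc j)) (c t)) (≡-sym (position-next-last i position-pivot))
            (subst (λ t → Q i (c t) (c 0)) (≡-sym sj≡l) last)

  -- Descends from `i` to `zero` through predecessors, along which `next` never wraps around.
  constant : {f : Fin M → A} → (∀ i → f i ≡ f (next i)) → ∀ i → f i ≡ f zero
  constant {f = f} step i = go (toℕ i) i refl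
    where
    go : ∀ k i → toℕ i ≡ k → f i ≡ f zero
    go zero    i eq = cong f (toℕ-injective eq)
    go (suc k) i eq = trans (cong f (≡-sym next-j≡i)) (trans (≡-sym (step j)) (go k j (toℕ-fromℕ< k<M)))
      where
      sk<M : suc k < M
      sk<M = subst (_< M) eq (toℕ<n i)
      k<M : k < M
      k<M = <-trans (n<1+n k) sk<M
      j : Fin M
      j = fromℕ< k<M
      next-j≡i : next j ≡ i
      next-j≡i = toℕ-injective (begin
        toℕ (next j)         ≡⟨ toℕ-next j ⟩
        suc (toℕ j) % M      ≡⟨ cong (λ t → suc t % M) (toℕ-fromℕ< k<M) ⟩
        suc k % M            ≡⟨ m<n⇒m%n≡m sk<M ⟩
        suc k                ≡⟨ eq ⟨
        toℕ i                ∎)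
        where open ≡-Reasoning

  -- Two consecutive edges of different colours exhaust `Bool`. If there are none, the colouring is
  -- constant and `zero` serves.
  pivot : (col : Fin M → Bool) → ∃ λ i₀ → ∀ i → col i ≡ col i₀ ⊎ col i ≡ col (next i₀)
  pivot col with any? (λ i → ¬? (col i ≟ᵇ col (next i)))
  ... | yes (i₀ , differ) = i₀ , λ i → case (col i) (col i₀) (col (next i₀)) differ
    where
    case : ∀ a b c → b ≢ c → a ≡ b ⊎ a ≡ c
    case false false c     b≢c = inj₁ refl
    case true  true  c     b≢c = inj₁ refl
    case false true  false b≢c = inj₂ refl
    case true  false true  b≢c = inj₂ refl
    case false true  true  b≢c = contradiction refl b≢c
    case true  false false b≢c = contradiction refl b≢c
  ... | no none = zero , λ i → inj₁ (constant (λ i → decidable-stable (col i ≟ᵇ col (next i)) (λ ≢ → none (i , ≢))) i)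

-- Edge counts

2*choose2 : ∀ n → 2 * choose2 n + n ≡ n * n
2*choose2 zero    = refl
2*choose2 (suc n) = begin
  2 * (n + choose2 n) + suc n          ≡⟨ rearrange n (choose2 n) ⟩
  (2 * choose2 n + n) + suc (2 * n)    ≡⟨ cong (_+ suc (2 * n)) (2*choose2 n) ⟩
  n * n + suc (2 * n)                  ≡⟨ square n ⟩
  suc n * suc n                        ∎
  where
  open ≡-Reasoning
  rearrange : ∀ n c → 2 * (n + c) + (1 + n) ≡ (2 * c + n) + (1 + 2 * n)
  rearrange = solve-∀
  square : ∀ n → n * n + (1 + 2 * n) ≡ (1 + n) * (1 + n)
  square = solve-∀

-- `edges` counts pairs in increasing order only. After adding the sum with indices exchanged, at
-- most one of `f x y` and `f y x` is nonzero.
2*edges≤ : ∀ {n} (G : Graph n) → 2 * edges G ≤ ∑ (allFin n) (λ x → ∑ (allFin n) (λ y → 𝟙 (adj G x y)))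
2*edges≤ {n} G = begin
  2 * edges G                                  ≡⟨ cong (edges G +_) (+-identityʳ (edges G)) ⟩
  edges G + edges G                            ≡⟨ cong₂ _+_ edges≡ (trans edges≡ (∑-swap V V f)) ⟩
  ∑ V (λ x → ∑ V (f x)) + ∑ V (λ x → ∑ V (λ y → f y x)) ≡⟨ ∑-+ V _ _ ⟨
  ∑ V (λ x → ∑ V (f x) + ∑ V (λ y → f y x))   ≡⟨ ∑-cong V (λ x → ∑-+ V _ _) ⟨
  ∑ V (λ x → ∑ V (λ y → f x y + f y x))       ≤⟨ ∑-mono V (λ x → ∑-mono V (λ y → ordered x y)) ⟩
  ∑ V (λ x → ∑ V (λ y → 𝟙 (adj G x y)))      ∎
  where
  open ≤-Reasoning
  V = allFin n
  f : Fin n → Fin n → ℕ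
  f x y = 𝟙 ((toℕ x <ᵇ toℕ y) ∧ adj G x y)
  edges≡ : edges G ≡ ∑ V (λ x → ∑ V (f x))
  edges≡ = trans (∑-cong (cartesianProduct V V) (λ _ → refl)) (∑-cartesianProduct V V (λ { (x , y) → f x y }))
  <ᵇ-asym : ∀ a b → (a <ᵇ b) ≡ true → (b <ᵇ a) ≡ false
  <ᵇ-asym zero    (suc b) _  = refl
  <ᵇ-asym (suc a) (suc b) eq = <ᵇ-asym a b eq
  ordered : ∀ x y → f x y + f y x ≤ 𝟙 (adj G x y)
  ordered x y rewrite Graph.sym G y x with toℕ x <ᵇ toℕ y in lt
  ... | true  rewrite <ᵇ-asym (toℕ x) (toℕ y) lt = ≤-reflexive (+-identityʳ _)
  ... | false with toℕ y <ᵇ toℕ x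
  ...   | true  = ≤-refl
  ...   | false = z≤n

-- Choice of constants and conclusion

bichromatic-cycle : ∀ {n} (G H : Graph n) q m t →
  suc q * (n * suc n) + suc (q * (2 * (q * m * (q * m)))) ≤ q * (4 * t) → t ≤ edges G → t ≤ edges H →
  ∀ L → suc L ≤ m → ∃ λ (c : ℕ → Fin n) →
    (∀ {i j} → i ≤ suc L → j ≤ suc L → c i ≡ c j → i ≡ j) ×
    (∀ i → i < L → Edge G (c (1 + i)) (c (2 + i)) × Edge H (c (1 + i)) (c (2 + i))) ×
    Edge G (c (suc L)) (c 0) × Edge H (c 0) (c 1)
bichromatic-cycle {n} G H q m t big t≤G t≤H =
  let S , uq , dense , large = prune q K n (allFin n) (≤-reflexive |V|≡n) (allFin⁺ n) dense₀
  in Embed.cycle G H q m uq (dense⇒long w≤2 q (q * m) S dense)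
       (λ {v} v∈S → subst (λ d → suc q * length S < q * d) (∑-+ S _ _) (All.lookup large v∈S))
  where
  -- The slack for which `dense⇒long` leaves more than `q * m` vertices, as the embedding requires.
  K = suc (q * (2 * (q * m * (q * m))))
  w : Fin n → Fin n → ℕ
  w x y = 𝟙 (adj G x y) + 𝟙 (adj H x y)
  open Prune w (λ x y → cong₂ (λ a b → 𝟙 a + 𝟙 b) (Graph.sym G x y) (Graph.sym H x y))
  𝟙≤1 : ∀ b → 𝟙 b ≤ 1
  𝟙≤1 false = z≤n
  𝟙≤1 true  = ≤-refl
  w≤2 : ∀ x y → w x y ≤ 2
  w≤2 x y = +-mono-≤ (𝟙≤1 (adj G x y)) (𝟙≤1 (adj H x y))
  |V|≡n : length (allFin n) ≡ n
  |V|≡n = length-tabulate {n = n} (λ i → i)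
  4t≤weight : 4 * t ≤ weight (allFin n)
  4t≤weight = begin
    4 * t                        ≡⟨ *-distribʳ-+ t 2 2 ⟩
    2 * t + 2 * t                ≤⟨ +-mono-≤ (*-monoʳ-≤ 2 t≤G) (*-monoʳ-≤ 2 t≤H) ⟩
    2 * edges G + 2 * edges H    ≤⟨ +-mono-≤ (2*edges≤ G) (2*edges≤ H) ⟩
    ∑ V (λ x → ∑ V (λ y → 𝟙 (adj G x y))) + ∑ V (λ x → ∑ V (λ y → 𝟙 (adj H x y))) ≡⟨ ∑-+ V _ _ ⟨
    ∑ V (λ x → ∑ V (λ y → 𝟙 (adj G x y)) + ∑ V (λ y → 𝟙 (adj H x y)))  ≡⟨ ∑-cong V (λ x → ∑-+ V _ _) ⟨
    weight V ∎
    where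
    open ≤-Reasoning
    V = allFin n
  dense₀ : Dense q K (allFin n)
  dense₀ = subst (λ s → suc q * (s * suc s) + K ≤ q * weight (allFin n)) (≡-sym |V|≡n)
    (≤-trans big (*-monoʳ-≤ q 4t≤weight))

-- Doubling the hypothesis gives `4qt > (q+2)(n² - n)`. This lower bound exceeds `(q+1)(n² + n)` by
-- `n² - (2q+3)n ≥ Kn ≥ K`. Adding `(q + 2) * n` to both sides avoids subtraction.
surplus : ∀ q K n t → 2 * q + 3 + K ≤ n → 0 < n → (q + 2) * choose2 n < 2 * q * t →
  suc q * (n * suc n) + K ≤ q * (4 * t)
surplus q K n t N≤n 0<n big = +-cancelʳ-≤ ((q + 2) * n) _ _ (begin
  suc q * (n * suc n) + K + (q + 2) * n              ≡⟨ regroup q K n ⟩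
  suc q * (n * n) + ((2 * q + 3) * n + K * 1)        ≤⟨ +-monoʳ-≤ s (+-monoʳ-≤ ((2 * q + 3) * n) (*-monoʳ-≤ K 0<n)) ⟩
  suc q * (n * n) + ((2 * q + 3) * n + K * n)        ≡⟨ cong (s +_) (*-distribʳ-+ n (2 * q + 3) K) ⟨
  suc q * (n * n) + (2 * q + 3 + K) * n              ≤⟨ +-monoʳ-≤ s (*-monoˡ-≤ n N≤n) ⟩
  suc q * (n * n) + n * n                            ≡⟨ collect q (n * n) ⟩
  (q + 2) * (n * n)                                  ≡⟨ cong ((q + 2) *_) (2*choose2 n) ⟨
  (q + 2) * (2 * choose2 n + n)                      ≡⟨ expand q (choose2 n) n ⟩
  2 * ((q + 2) * choose2 n) + (q + 2) * n            ≤⟨ +-monoˡ-≤ ((q + 2) * n) (*-monoʳ-≤ 2 (<⇒≤ big)) ⟩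
  2 * (2 * q * t) + (q + 2) * n                      ≡⟨ cong (_+ (q + 2) * n) (four q t) ⟩
  q * (4 * t) + (q + 2) * n                          ∎)
  where
  open ≤-Reasoning
  s = suc q * (n * n)
  regroup : ∀ q K n → (1 + q) * (n * (1 + n)) + K + (q + 2) * n ≡ (1 + q) * (n * n) + ((2 * q + 3) * n + K * 1)
  regroup = solve-∀
  collect : ∀ q s → (1 + q) * s + s ≡ (q + 2) * s
  collect = solve-∀
  expand : ∀ q c n → (q + 2) * (2 * c + n) ≡ 2 * ((q + 2) * c) + (q + 2) * n
  expand = solve-∀
  four : ∀ q t → 2 * (2 * q * t) ≡ q * (4 * t)
  four = solve-∀

-- With `q = suc e` the bound reads `T ≤ (1/2 + 1/q) * choose2 n` for all large `n`; as `e` is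
-- arbitrary, the limit is at most 1/2.
theorem1p2 : ∀ (k : ℕ) (col : Fin (3 + k) → Bool) (e : ℕ) →
    ∃ λ N → ∀ (n : ℕ) → N ≤ n → ∀ (R B : Graph n) → ¬ ContainsCycle R B col →
    ∀ (T : ℕ) → T ≤ edges R → T ≤ edges B →
    2 * suc e * T ≤ (suc e + 2) * choose2 n
theorem1p2 k col e = 2 * q + 3 + K , λ n N≤n R B noCycle T T≤R T≤B →
  ≮⇒≥ λ big → noCycle (cycle n N≤n R B T T≤R T≤B big)
  where
  q = suc e
  -- The path has `suc k` edges, hence `2 + k` vertices that the closing vertex must avoid.
  m = 2 + k
  K = suc (q * (2 * (q * m * (q * m))))
  cycle : ∀ n → 2 * q + 3 + K ≤ n → ∀ (R B : Graph n) T → T ≤ edges R → T ≤ edges B →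
    (q + 2) * choose2 n < 2 * q * T → ContainsCycle R B col
  cycle n N≤n R B T T≤R T≤B big
    with i₀ , two ← pivot col
    = let c , c-inj , inner , last , first =
            bichromatic-cycle (graph (col i₀)) (graph (col (next i₀))) q m T
              (surplus q K n T N≤n (≤-trans (s≤s z≤n) N≤n) big)
              (T≤edges (col i₀)) (T≤edges (col (next i₀))) (suc k) ≤-refl
      in Rotation.rotate i₀ Q c (s≤s z≤n) c-inj
           (λ i j j<l → inner-edge i (inner j (≤-pred j<l))) (edge (col i₀) last) (edge (col (next i₀)) first)
    where
    graph : Bool → Graph n
    graph b = if b then R else B
    Q : Fin (3 + k) → Fin n → Fin n → Set
    Q i x y = if col i then Edge R x y else Edge B x y
    T≤edges : ∀ b → T ≤ edges (graph b)
    T≤edges true  = T≤R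
    T≤edges false = T≤B
    edge : ∀ b {x y} → Edge (graph b) x y → if b then Edge R x y else Edge B x y
    edge true  xy = xy
    edge false xy = xy
    inner-edge : ∀ i {x y} → Edge (graph (col i₀)) x y × Edge (graph (col (next i₀))) x y → Q i x y
    -- Inner edges lie in both graphs, so whichever of the two colours edge `i` has is available.
    inner-edge i (xy₁ , xy₂) with two i
    ... | inj₁ eq = edge (col i) (subst (λ b → Edge (graph b) _ _) (≡-sym eq) xy₁)
    ... | inj₂ eq = edge (col i) (subst (λ b → Edge (graph b) _ _) (≡-sym eq) xy₂)
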